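{- Let $\mathbb F$ be a field. For every $d\in\mathbb N$, every $n\in\mathbb N$ and every $d$-mode tensor $T\in(\mathbb F^n)^{\otimes d}$, the asymptotic circuit complexity exponent satisfies $\eta(T)<\frac d2+1$.
   Context: A $d$-mode tensor over $\mathbb F$ is a polynomial in variables partitioned into $d$ nonempty disjoint sets $X_1,\dots,X_d$ (modes) all of whose monomials contain exactly one variable from each mode, with degree one; $(\mathbb F^n)^{\otimes d}$ denotes those in which each mode has $n$ variables. The Kronecker product $S\otimes T$ of $d$-mode tensors with modes $X_i$ and $Y_i$ is the polynomial product $ST$, viewed as a $d$-mode tensor with modes $X_i\times Y_i$ (a product $xy$ with $x\in X_i$, $y\in Y_i$ is regarded as one variable); $T^{\otimes k}$ is the $k$-fold Kronecker power. An arithmetic circuit is a directed acyclic graph whose sources (inputs) are labeled by field elements or variables, whose other vertices (gates) are labeled $+$ or $\times$ (with arbitrary fan-in), and whose edges (wires) are labeled by field elements by which the transmitted value is multiplied; its size is the number of wires, and $\mathrm C(T)$ is the minimum size of an arithmetic circuit over $\mathbb F$ computing $T$. For $T\in(\mathbb F^n)^{\otimes d}$, $\eta(T)=\inf\{\beta\ge 0:\mathrm C(T^{\otimes k})=O(n^{\beta k})\text{ as }k\to\infty\}$. -}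

module Defs where

open import Algebra.Apartness.Bundles using (HeytingField)
open import Data.Fin.Base using (Fin; zero; suc; quotient; remainder)
open import Data.Integer.Base using (∣_∣)
open import Data.List.Base using (List; []; _∷_; foldr; map; allFin; cartesianProductWith)
open import Data.List.NonEmpty.Base as List⁺ using (List⁺)
open import Data.Nat.Base as ℕ using (ℕ; zero; suc; NonZero)
open import Data.Product.Base using (_×_; _,_; ∃-syntax)
open import Data.Rational.Unnormalised.Base as ℚ using (ℚᵘ; 0ℚᵘ; ↥_; ↧ₙ_)
open import Data.Vec.Base as Vec using (Vec; lookup)
open import Level using (Level; _⊔_) renaming (suc to lsuc)

-- An extended real, given by its upper cut: the set of rationals strictly
-- above it.

UpperReal : ∀ ℓ → Set (lsuc ℓ)
UpperReal ℓ = ℚᵘ → Set ℓ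

infix 4 _<ᵘ_

_<ᵘ_ : ∀ {ℓ} → UpperReal ℓ → ℚᵘ → Set ℓ
x <ᵘ r = x r

-- The infimum of S is below r exactly when some element of S is; for S empty
-- the cut is empty, which represents +∞.

inf : ∀ {ℓ} → (ℚᵘ → Set ℓ) → UpperReal ℓ
inf S r = ∃[ β ] S β × β ℚ.< r

-- For a nonnegative rational β = p / q, the inequality s ≤ c · n^(β k) between
-- real numbers, with both sides raised to the power q.

_≤_·_^[_*_] : ℕ → ℕ → ℕ → ℚᵘ → ℕ → Set
s ≤ c · n ^[ β * k ] = s ℕ.^ q ℕ.≤ c ℕ.^ q ℕ.* n ℕ.^ (p ℕ.* k)
  where
  p = ∣ ↥ β ∣
  q = ↧ₙ β

allIndices : ∀ d n → List (Vec (Fin n) d)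
allIndices zero    n = Vec.[] ∷ []
allIndices (suc d) n = cartesianProductWith Vec._∷_ (allFin n) (allIndices d n)

module _ {c ℓ₁ ℓ₂ : Level} (F : HeytingField c ℓ₁ ℓ₂) where

  open HeytingField F using (Carrier; _≈_; _+_; _*_; 0#; 1#)

  -- The polynomial ring F[V], presented as the free commutative F-algebra on
  -- V: formal expressions modulo _≈ₚ_.  Negation is multiplication by
  -- con (- 1#).  Polynomials are not identified with the functions they
  -- induce, which matters over finite fields.

  infixl 6 _+ₚ_
  infixl 7 _*ₚ_
  infix  4 _≈ₚ_

  data Poly (V : Set) : Set c where
    con  : Carrier → Poly V
    var  : V → Poly V
    _+ₚ_ : Poly V → Poly V → Poly V
    _*ₚ_ : Poly V → Poly V → Poly V

  data _≈ₚ_ {V : Set} : Poly V → Poly V → Set (c ⊔ ℓ₁) where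
    ≈ₚ-refl     : ∀ {p} → p ≈ₚ p
    ≈ₚ-sym      : ∀ {p q} → p ≈ₚ q → q ≈ₚ p
    ≈ₚ-trans    : ∀ {p q r} → p ≈ₚ q → q ≈ₚ r → p ≈ₚ r
    +ₚ-cong     : ∀ {p p′ q q′} → p ≈ₚ p′ → q ≈ₚ q′ → p +ₚ q ≈ₚ p′ +ₚ q′
    *ₚ-cong     : ∀ {p p′ q q′} → p ≈ₚ p′ → q ≈ₚ q′ → p *ₚ q ≈ₚ p′ *ₚ q′
    +ₚ-assoc    : ∀ p q r → (p +ₚ q) +ₚ r ≈ₚ p +ₚ (q +ₚ r)
    +ₚ-comm     : ∀ p q → p +ₚ q ≈ₚ q +ₚ p
    +ₚ-identity : ∀ p → con 0# +ₚ p ≈ₚ p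
    *ₚ-assoc    : ∀ p q r → (p *ₚ q) *ₚ r ≈ₚ p *ₚ (q *ₚ r)
    *ₚ-comm     : ∀ p q → p *ₚ q ≈ₚ q *ₚ p
    *ₚ-identity : ∀ p → con 1# *ₚ p ≈ₚ p
    *ₚ-zero     : ∀ p → con 0# *ₚ p ≈ₚ con 0#
    *ₚ-distrib  : ∀ p q r → p *ₚ (q +ₚ r) ≈ₚ p *ₚ q +ₚ p *ₚ r
    con-cong    : ∀ {a b} → a ≈ b → con a ≈ₚ con b
    con-+       : ∀ a b → con (a + b) ≈ₚ con a +ₚ con b
    con-*       : ∀ a b → con (a * b) ≈ₚ con a *ₚ con b

  sumₚ : ∀ {V} → List (Poly V) → Poly V
  sumₚ = foldr _+ₚ_ (con 0#)

  productₚ : ∀ {V} → List (Poly V) → Poly V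
  productₚ = foldr _*ₚ_ (con 1#)

  -- A tensor in (Fⁿ)^⊗d is given by its coefficients: T v is the coefficient
  -- of the monomial that takes the variable number v_i from mode i.

  Tensor : ℕ → ℕ → Set c
  Tensor d n = Vec (Fin n) d → Carrier

  -- Variable (i , a) is the a-th variable of mode i.

  monomial : ∀ {d n} → Vec (Fin n) d → Poly (Fin d × Fin n)
  monomial {d} v = productₚ (map (λ i → var (i , lookup v i)) (allFin d))

  toPoly : ∀ {d n} → Tensor d n → Poly (Fin d × Fin n)
  toPoly {d} {n} T = sumₚ (map (λ v → con (T v) *ₚ monomial v) (allIndices d n))

  -- The product variable x_{i,a} y_{i,b} is the variable of mode i numbered by
  -- the image of (a , b) under the bijection Fin m × Fin n ≅ Fin (m * n).

  infixr 7 _⊗_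

  _⊗_ : ∀ {d m n} → Tensor d m → Tensor d n → Tensor d (m ℕ.* n)
  _⊗_ {m = m} {n} S T v = S (Vec.map (quotient n) v) * T (Vec.map (remainder {m} n) v)

  _^⊗_ : ∀ {d n} → Tensor d n → (k : ℕ) → Tensor d (n ℕ.^ k)
  T ^⊗ zero    = λ _ → 1#
  T ^⊗ (suc k) = T ⊗ (T ^⊗ k)

  -- A circuit is listed in a topological order of its graph, and its vertices
  -- are numbered backwards: zero is the last one.  A wire into a gate is an
  -- earlier vertex with the field element labelling the wire; parallel wires
  -- are allowed, so x ↦ x² is a product gate with two wires from x.

  data Vertex (V : Set) (m : ℕ) : Set c where
    constant : Carrier → Vertex V m
    input    : V → Vertex V m
    sumGate  : List⁺ (Fin m × Carrier) → Vertex V m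
    prodGate : List⁺ (Fin m × Carrier) → Vertex V m

  infixl 5 _▷_

  data Circuit (V : Set) : ℕ → Set c where
    ∅   : Circuit V zero
    _▷_ : ∀ {m} → Circuit V m → Vertex V m → Circuit V (suc m)

  fanIn : ∀ {V m} → Vertex V m → ℕ
  fanIn (constant _)  = 0
  fanIn (input _)     = 0
  fanIn (sumGate ws)  = List⁺.length ws
  fanIn (prodGate ws) = List⁺.length ws

  size : ∀ {V m} → Circuit V m → ℕ
  size ∅       = 0
  size (C ▷ g) = size C ℕ.+ fanIn g

  transmitted : ∀ {V m} → (Fin m → Poly V) → Fin m × Carrier → Poly V
  transmitted ρ (i , a) = con a *ₚ ρ i

  vertexValue : ∀ {V m} → (Fin m → Poly V) → Vertex V m → Poly V
  vertexValue ρ (constant a)  = con a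
  vertexValue ρ (input x)     = var x
  vertexValue ρ (sumGate ws)  = sumₚ (map (transmitted ρ) (List⁺.toList ws))
  vertexValue ρ (prodGate ws) = productₚ (map (transmitted ρ) (List⁺.toList ws))

  value : ∀ {V m} → Circuit V m → Fin m → Poly V
  value (C ▷ g) zero    = vertexValue (value C) g
  value (C ▷ g) (suc i) = value C i

  Computes : ∀ {V m} → Circuit V m → Poly V → Set (c ⊔ ℓ₁)
  Computes C p = ∃[ i ] value C i ≈ₚ p

  -- The minimum size C(T) of a circuit computing T is at most s.

  C[_]≤_ : ∀ {d n} → Tensor d n → ℕ → Set (c ⊔ ℓ₁)
  C[ T ]≤ s = ∃[ m ] ∃[ C ] Computes {m = m} C (toPoly T) × size C ℕ.≤ s

  -- C(T^⊗k) = O(n^(β k)) as k → ∞.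

  PowerBound : ∀ {d n} → Tensor d n → ℚᵘ → Set (c ⊔ ℓ₁)
  PowerBound {n = n} T β =
    ∃[ a ] ∃[ k₀ ] ∀ k → k₀ ℕ.≤ k → ∃[ s ] C[ T ^⊗ k ]≤ s × s ≤ a · n ^[ β * k ]

  -- For n ≥ 1 the exponents β with this bound are upward closed, so that
  -- restricting to rational β does not change the infimum.

  η : ∀ {d n} .{{_ : NonZero n}} → Tensor d n → UpperReal (c ⊔ ℓ₁)
  η T = inf (λ β → 0ℚᵘ ℚ.≤ β × PowerBound T β)

{-# OPTIONS --safe #-}
module Submission where

-- Split the modes into ⌊d/2⌋ and ⌈d/2⌉, so that T is flattened to a matrix M.
-- T^⊗k is then the bilinear form of M^⊗k on the monomials of the two halves,
-- and Yates' algorithm multiplies M^⊗k by a vector with O(k · n^(⌈d/2⌉ k))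
-- wires.  The factor k costs nothing in the exponent when n ≥ 2, and
-- ⌈d/2⌉ ≤ d/2 + 1/2 < d/2 + 1; for n = 1 the size is bounded outright.

open import Defs
open import Algebra.Apartness.Bundles using (HeytingField)
open import Algebra.Bundles using (CommutativeSemiring)
open import Algebra.Structures.Biased using (isCommutativeMonoidˡ; isCommutativeSemiringˡ)
open import Data.Bool.Base using (true; false; if_then_else_)
open import Data.Empty using (⊥-elim)
open import Data.Fin.Base using (Fin; zero; suc; _↑ˡ_; _↑ʳ_; combine; quotient; remainder)
open import Data.Fin.Properties using (remQuot-combine)
open import Data.Integer.Base using (+_)
import Data.Integer.Base as ℤ
import Data.Integer.Properties as ℤ
open import Data.List.Base using (List; []; _∷_; _++_; map; length; tabulate; allFin; cartesianProductWith)
open import Data.List.NonEmpty.Base using (_∷_)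
open import Data.List.Properties using (map-∘; map-tabulate; tabulate-cong; length-map; length-++; length-tabulate)
open import Data.Nat.Base using (ℕ; NonZero)
import Data.Nat.Base as ℕ
import Data.Nat.DivMod as ℕ
import Data.Nat.Properties as ℕ
open import Data.Nat.Tactic.RingSolver using (solve-∀)
open import Data.Product.Base using (_×_; _,_; proj₁; proj₂; ∃-syntax; uncurry)
open import Data.Rational.Unnormalised.Base using (_/_; _+_; 1ℚᵘ)
open import Data.Rational.Unnormalised.Base using (ℚᵘ; mkℚᵘ; 0ℚᵘ; *<*; *≤*)
import Data.Rational.Unnormalised.Base as ℚ
open import Data.Unit.Base using (⊤; tt)
open import Data.Vec.Base as Vec using (Vec; lookup)
import Data.Vec.Properties as Vec
open import Function.Base using (_∘_)
open import Level using (_⊔_)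
open import Relation.Binary.PropositionalEquality using (_≡_; refl; sym; trans; cong; cong₂; subst; subst₂)
open import Relation.Binary.Structures using (IsEquivalence)

-- Enumeration of multi-indices

length-allIndices : ∀ d n → length (allIndices d n) ≡ n ℕ.^ d
length-allIndices ℕ.zero    n = refl
length-allIndices (ℕ.suc d) n =
  trans (length-product (allFin n) (allIndices d n))
        (cong₂ ℕ._*_ (length-tabulate {n = n} (λ i → i)) (length-allIndices d n))
  where
  length-product : ∀ {A B C : Set} {f : A → B → C} xs ys →
    length (cartesianProductWith f xs ys) ≡ length xs ℕ.* length ys
  length-product []       ys = refl
  length-product {f = f} (x ∷ xs) ys =
    trans (length-++ (map (f x) ys))
          (cong₂ ℕ._+_ (length-map (f x) ys) (length-product xs ys))

tabulate-+ : ∀ {a} {A : Set a} m {n} (f : Fin (m ℕ.+ n) → A) →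
  tabulate f ≡ tabulate (f ∘ (_↑ˡ n)) ++ tabulate (f ∘ (m ↑ʳ_))
tabulate-+ ℕ.zero    f = refl
tabulate-+ (ℕ.suc m) f = cong (f zero ∷_) (tabulate-+ m (f ∘ suc))

-- `_⊗_` reads its factors through `quotient` and `remainder` in each mode. This reassembles the
-- index, so that sums over the indices of a Kronecker product become double sums.
combineᵛ : ∀ {m n e} → Vec (Fin m) e → Vec (Fin n) e → Vec (Fin (m ℕ.* n)) e
combineᵛ = Vec.zipWith combine

quotient-combineᵛ : ∀ {m n e} (v : Vec (Fin m) e) (w : Vec (Fin n) e) →
  Vec.map (quotient {m} n) (combineᵛ v w) ≡ v
quotient-combineᵛ Vec.[]       Vec.[]       = refl
quotient-combineᵛ (i Vec.∷ v) (j Vec.∷ w) =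
  cong₂ Vec._∷_ (cong proj₁ (remQuot-combine i j)) (quotient-combineᵛ v w)

remainder-combineᵛ : ∀ {m n e} (v : Vec (Fin m) e) (w : Vec (Fin n) e) →
  Vec.map (remainder {m} n) (combineᵛ v w) ≡ w
remainder-combineᵛ Vec.[]       Vec.[]       = refl
remainder-combineᵛ (i Vec.∷ v) (j Vec.∷ w) =
  cong₂ Vec._∷_ (cong proj₂ (remQuot-combine i j)) (remainder-combineᵛ v w)

-- Wire counts and their growth

-- One recursive call for each of the n^e leading digits of the column index, then a sum of fan-in
-- n^e for each of the (n^(k+1))^d rows. The base case is a 1 × 1 matrix; its powers of 1 have the
-- form that `forVec` and `buildVecSum` produce.
yatesCost : (d e n k : ℕ) → ℕ
yatesCost d e n ℕ.zero    = 1 ℕ.^ d ℕ.* 1 ℕ.^ e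
yatesCost d e n (ℕ.suc k) = n ℕ.^ e ℕ.* yatesCost d e n k ℕ.+ (n ℕ.^ ℕ.suc k) ℕ.^ d ℕ.* n ℕ.^ e

-- The summands follow the construction: monomials of the second half, Yates' algorithm, monomials
-- of the first half, two-wire products of these with the output of Yates, final sum.
splitCost : (d e n k : ℕ) → ℕ
splitCost d e n k = N ℕ.^ e ℕ.* e ℕ.+ (yatesCost d e n k ℕ.+ (N ℕ.^ d ℕ.* d ℕ.+ (N ℕ.^ d ℕ.* 2 ℕ.+ N ℕ.^ d)))
  where N = n ℕ.^ k

module _ where

  open ℕ.≤-Reasoning

  ^-distrib-* : ∀ x y q → (x ℕ.* y) ℕ.^ q ≡ x ℕ.^ q ℕ.* y ℕ.^ q
  ^-distrib-* x y ℕ.zero    = refl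
  ^-distrib-* x y (ℕ.suc q) =
    trans (cong (x ℕ.* y ℕ.*_) (^-distrib-* x y q)) (ℕ.[m*n]*[o*p]≡[m*o]*[n*p] x y _ _)

  ^-swap : ∀ n k h → (n ℕ.^ k) ℕ.^ h ≡ (n ℕ.^ h) ℕ.^ k
  ^-swap n k h = trans (ℕ.^-*-assoc n k h) (trans (cong (n ℕ.^_) (ℕ.*-comm k h)) (sym (ℕ.^-*-assoc n h k)))

  power-bound : ∀ n .{{_ : NonZero n}} k {d h} → d ℕ.≤ h → (n ℕ.^ k) ℕ.^ d ℕ.≤ (n ℕ.^ h) ℕ.^ k
  power-bound n k {d} {h} d≤h = begin
    (n ℕ.^ k) ℕ.^ d ≤⟨ ℕ.^-monoʳ-≤ (n ℕ.^ k) {{ℕ.m^n≢0 n k}} d≤h ⟩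
    (n ℕ.^ k) ℕ.^ h ≡⟨ ^-swap n k h ⟩
    (n ℕ.^ h) ℕ.^ k ∎

  -- With D = n^h the recursion reads c(k+1) ≤ D · c(k) + D^(k+2). Each level adds one more term of
  -- top order, so only a factor linear in k is lost.
  yatesCost-bound : ∀ {d e h} n .{{_ : NonZero n}} → d ℕ.≤ h → e ℕ.≤ h → ∀ k →
    yatesCost d e n k ℕ.≤ ℕ.suc k ℕ.* (n ℕ.^ h) ℕ.^ ℕ.suc k
  yatesCost-bound {d} {e} {h} n d≤h e≤h ℕ.zero = begin
    1 ℕ.^ d ℕ.* 1 ℕ.^ e      ≡⟨ cong₂ ℕ._*_ (ℕ.^-zeroˡ d) (ℕ.^-zeroˡ e) ⟩
    1                        ≤⟨ ℕ.m^n>0 n h ⟩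
    n ℕ.^ h                  ≡⟨ ℕ.^-identityʳ _ ⟨
    (n ℕ.^ h) ℕ.^ 1          ≡⟨ ℕ.*-identityˡ _ ⟨
    1 ℕ.* (n ℕ.^ h) ℕ.^ 1    ∎
  yatesCost-bound {d} {e} {h} n d≤h e≤h (ℕ.suc k) = begin
    n ℕ.^ e ℕ.* yatesCost d e n k ℕ.+ (n ℕ.^ ℕ.suc k) ℕ.^ d ℕ.* n ℕ.^ e
      ≤⟨ ℕ.+-mono-≤ (ℕ.*-mono-≤ (ℕ.^-monoʳ-≤ n e≤h) (yatesCost-bound n d≤h e≤h k))
           (ℕ.*-mono-≤ (power-bound n (ℕ.suc k) d≤h) (ℕ.^-monoʳ-≤ n e≤h)) ⟩
    D ℕ.* (ℕ.suc k ℕ.* D ℕ.^ ℕ.suc k) ℕ.+ D ℕ.^ ℕ.suc k ℕ.* D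
      ≡⟨ regroup D k (D ℕ.^ ℕ.suc k) ⟩
    ℕ.suc (ℕ.suc k) ℕ.* D ℕ.^ ℕ.suc (ℕ.suc k) ∎
    where
    D = n ℕ.^ h
    regroup : ∀ D k P → D ℕ.* (ℕ.suc k ℕ.* P) ℕ.+ P ℕ.* D ≡ ℕ.suc (ℕ.suc k) ℕ.* (D ℕ.* P)
    regroup = solve-∀

  -- `n ^ h` comes from the exponent `suc k` in the bound for Yates, `h + h` from the two families
  -- of monomials, and 3 from the pairing and the final sum.
  splitFactor : (n h : ℕ) → ℕ
  splitFactor n h = n ℕ.^ h ℕ.+ (h ℕ.+ h ℕ.+ 3)

  splitCost-bound : ∀ {d e h} n .{{_ : NonZero n}} → d ℕ.≤ h → e ℕ.≤ h → ∀ k →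
    splitCost d e n k ℕ.≤ ℕ.suc k ℕ.* ((n ℕ.^ h) ℕ.^ k ℕ.* splitFactor n h)
  splitCost-bound {d} {e} {h} n d≤h e≤h k = begin
    splitCost d e n k
      ≤⟨ ℕ.+-mono-≤ (ℕ.*-mono-≤ N^e≤P e≤h)
           (ℕ.+-mono-≤ (yatesCost-bound n d≤h e≤h k)
             (ℕ.+-mono-≤ (ℕ.*-mono-≤ N^d≤P d≤h) (ℕ.+-mono-≤ (ℕ.*-monoˡ-≤ 2 N^d≤P) N^d≤P))) ⟩
    P ℕ.* h ℕ.+ (ℕ.suc k ℕ.* (D ℕ.* P) ℕ.+ (P ℕ.* h ℕ.+ (P ℕ.* 2 ℕ.+ P)))
      -- Only the Yates term carries the factor k + 1. The other terms are padded with k further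
      -- copies so that it can be taken out of the whole sum.
      ≤⟨ ℕ.m≤m+n _ (k ℕ.* (P ℕ.* (h ℕ.+ h ℕ.+ 3))) ⟩
    P ℕ.* h ℕ.+ (ℕ.suc k ℕ.* (D ℕ.* P) ℕ.+ (P ℕ.* h ℕ.+ (P ℕ.* 2 ℕ.+ P))) ℕ.+ k ℕ.* (P ℕ.* (h ℕ.+ h ℕ.+ 3))
      ≡⟨ regroup P D h k ⟩
    ℕ.suc k ℕ.* (P ℕ.* splitFactor n h) ∎
    where
    D = n ℕ.^ h
    P = D ℕ.^ k
    N^d≤P : (n ℕ.^ k) ℕ.^ d ℕ.≤ P
    N^d≤P = power-bound n k d≤h
    N^e≤P : (n ℕ.^ k) ℕ.^ e ℕ.≤ P
    N^e≤P = power-bound n k e≤h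
    regroup : ∀ P D h k → P ℕ.* h ℕ.+ (ℕ.suc k ℕ.* (D ℕ.* P) ℕ.+ (P ℕ.* h ℕ.+ (P ℕ.* 2 ℕ.+ P)))
                            ℕ.+ k ℕ.* (P ℕ.* (h ℕ.+ h ℕ.+ 3))
                          ≡ ℕ.suc k ℕ.* (P ℕ.* (D ℕ.+ (h ℕ.+ h ℕ.+ 3)))
    regroup = solve-∀

  n<2^n : ∀ n → n ℕ.< 2 ℕ.^ n
  n<2^n ℕ.zero    = ℕ.≤-refl
  n<2^n (ℕ.suc n) = begin
    ℕ.suc (ℕ.suc n)       ≤⟨ ℕ.+-mono-≤ (ℕ.m^n>0 2 n) (n<2^n n) ⟩
    2 ℕ.^ n ℕ.+ 2 ℕ.^ n   ≡⟨ cong (2 ℕ.^ n ℕ.+_) (ℕ.+-identityʳ _) ⟨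
    2 ℕ.^ ℕ.suc n         ∎

  -- From k < 4 (1 + ⌊k/4⌋) ≤ 4 · 2^⌊k/4⌋.
  [1+k]^4≤4^4*n^k : ∀ n → 2 ℕ.≤ n → ∀ k → ℕ.suc k ℕ.^ 4 ℕ.≤ 4 ℕ.^ 4 ℕ.* n ℕ.^ k
  [1+k]^4≤4^4*n^k n@(ℕ.suc _) 2≤n k = begin
    ℕ.suc k ℕ.^ 4                      ≤⟨ ℕ.^-monoˡ-≤ 4 1+k≤ ⟩
    (4 ℕ.* 2 ℕ.^ (k ℕ./ 4)) ℕ.^ 4        ≡⟨ ^-distrib-* 4 (2 ℕ.^ (k ℕ./ 4)) 4 ⟩
    4 ℕ.^ 4 ℕ.* (2 ℕ.^ (k ℕ./ 4)) ℕ.^ 4  ≡⟨ cong (4 ℕ.^ 4 ℕ.*_) (ℕ.^-*-assoc 2 (k ℕ./ 4) 4) ⟩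
    4 ℕ.^ 4 ℕ.* 2 ℕ.^ (k ℕ./ 4 ℕ.* 4)    ≤⟨ ℕ.*-monoʳ-≤ (4 ℕ.^ 4) (ℕ.^-monoʳ-≤ 2 {{_}} quot≤) ⟩
    4 ℕ.^ 4 ℕ.* 2 ℕ.^ k                ≤⟨ ℕ.*-monoʳ-≤ (4 ℕ.^ 4) (ℕ.^-monoˡ-≤ k 2≤n) ⟩
    4 ℕ.^ 4 ℕ.* n ℕ.^ k                ∎
    where
    quot≤ : k ℕ./ 4 ℕ.* 4 ℕ.≤ k
    quot≤ = ℕ.≤-trans (ℕ.m≤n+m _ (k ℕ.% 4)) (ℕ.≤-reflexive (sym (ℕ.m≡m%n+[m/n]*n k 4)))
    1+k≤ : ℕ.suc k ℕ.≤ 4 ℕ.* 2 ℕ.^ (k ℕ./ 4)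
    1+k≤ = begin
      ℕ.suc k                          ≡⟨ cong ℕ.suc (ℕ.m≡m%n+[m/n]*n k 4) ⟩
      ℕ.suc (k ℕ.% 4) ℕ.+ k ℕ./ 4 ℕ.* 4    ≤⟨ ℕ.+-monoˡ-≤ (k ℕ./ 4 ℕ.* 4) (ℕ.m%n<n k 4) ⟩
      ℕ.suc (k ℕ./ 4) ℕ.* 4              ≤⟨ ℕ.*-monoˡ-≤ 4 (n<2^n (k ℕ./ 4)) ⟩
      2 ℕ.^ (k ℕ./ 4) ℕ.* 4              ≡⟨ ℕ.*-comm (2 ℕ.^ (k ℕ./ 4)) 4 ⟩
      4 ℕ.* 2 ℕ.^ (k ℕ./ 4)              ∎

  -- Fourth powers clear the denominator of `exponent`. As 4h ≤ 2(d+e) + 2, the factor P^4 uses up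
  -- 2(d+e) + 2 of the multiples of k in the exponent; (k+1)^4 ≤ 4^4 · n^k uses the last one.
  splitCost^4-bound : ∀ {d e h} n → 2 ℕ.≤ n → d ℕ.≤ h → e ℕ.≤ h → h ℕ.+ h ℕ.≤ ℕ.suc (d ℕ.+ e) → ∀ k →
    splitCost d e n k ℕ.^ 4
      ℕ.≤ (4 ℕ.* splitFactor n h) ℕ.^ 4 ℕ.* n ℕ.^ ((2 ℕ.* (d ℕ.+ e) ℕ.+ 3) ℕ.* k)
  splitCost^4-bound {d} {e} {h} n@(ℕ.suc _) 2≤n d≤h e≤h h+h≤ k = begin
    splitCost d e n k ℕ.^ 4
      ≤⟨ ℕ.^-monoˡ-≤ 4 (splitCost-bound n d≤h e≤h k) ⟩
    (ℕ.suc k ℕ.* ((n ℕ.^ h) ℕ.^ k ℕ.* B)) ℕ.^ 4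
      ≡⟨ trans (^-distrib-* (ℕ.suc k) (P ℕ.* B) 4) (cong (ℕ.suc k ℕ.^ 4 ℕ.*_) (^-distrib-* P B 4)) ⟩
    ℕ.suc k ℕ.^ 4 ℕ.* (P ℕ.^ 4 ℕ.* B ℕ.^ 4)
      ≤⟨ ℕ.*-mono-≤ ([1+k]^4≤4^4*n^k n 2≤n k) (ℕ.*-monoˡ-≤ (B ℕ.^ 4) P^4≤) ⟩
    4 ℕ.^ 4 ℕ.* n ℕ.^ k ℕ.* (M ℕ.* B ℕ.^ 4)
      ≡⟨ trans (regroup (4 ℕ.^ 4) (n ℕ.^ k) M (B ℕ.^ 4))
           (cong (ℕ._* (M ℕ.* n ℕ.^ k)) (sym (^-distrib-* 4 B 4))) ⟩
    (4 ℕ.* B) ℕ.^ 4 ℕ.* (M ℕ.* n ℕ.^ k)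
      ≡⟨ cong ((4 ℕ.* B) ℕ.^ 4 ℕ.*_)
           (trans (sym (ℕ.^-distribˡ-+-* n ((2 ℕ.* δ ℕ.+ 2) ℕ.* k) k)) (cong (n ℕ.^_) (exponent δ k))) ⟩
    (4 ℕ.* B) ℕ.^ 4 ℕ.* n ℕ.^ ((2 ℕ.* δ ℕ.+ 3) ℕ.* k) ∎
    where
    δ = d ℕ.+ e
    P = (n ℕ.^ h) ℕ.^ k
    M = n ℕ.^ ((2 ℕ.* δ ℕ.+ 2) ℕ.* k)
    B = splitFactor n h
    regroup : ∀ u x y v → u ℕ.* x ℕ.* (y ℕ.* v) ≡ u ℕ.* v ℕ.* (y ℕ.* x)
    regroup = solve-∀
    exponent : ∀ δ k → (2 ℕ.* δ ℕ.+ 2) ℕ.* k ℕ.+ k ≡ (2 ℕ.* δ ℕ.+ 3) ℕ.* k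
    exponent = solve-∀
    double : ∀ h k → h ℕ.* k ℕ.* 4 ≡ 2 ℕ.* (h ℕ.+ h) ℕ.* k
    double = solve-∀
    double-suc : ∀ δ k → 2 ℕ.* ℕ.suc δ ℕ.* k ≡ (2 ℕ.* δ ℕ.+ 2) ℕ.* k
    double-suc = solve-∀
    P^4≤ : P ℕ.^ 4 ℕ.≤ M
    P^4≤ = begin
      P ℕ.^ 4                           ≡⟨ cong (ℕ._^ 4) (ℕ.^-*-assoc n h k) ⟩
      (n ℕ.^ (h ℕ.* k)) ℕ.^ 4           ≡⟨ ℕ.^-*-assoc n (h ℕ.* k) 4 ⟩
      n ℕ.^ (h ℕ.* k ℕ.* 4)             ≡⟨ cong (n ℕ.^_) (double h k) ⟩
      n ℕ.^ (2 ℕ.* (h ℕ.+ h) ℕ.* k)     ≤⟨ ℕ.^-monoʳ-≤ n (ℕ.*-monoˡ-≤ k (ℕ.*-monoʳ-≤ 2 h+h≤)) ⟩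
      n ℕ.^ (2 ℕ.* ℕ.suc δ ℕ.* k)       ≡⟨ cong (n ℕ.^_) (double-suc δ k) ⟩
      M                                 ∎

-- The exponent d / 2 + 3 / 4 leaves a factor n^(k/4) above n^(⌈d/2⌉k), which
-- absorbs the factor k + 1 of the recursion.
exponent : ℕ → ℚᵘ
exponent d = mkℚᵘ (+ (2 ℕ.* d ℕ.+ 3)) 3

exponent-nonNegative : ∀ d → 0ℚᵘ ℚ.≤ exponent d
exponent-nonNegative d = *≤* (subst (ℤ.0ℤ ℤ.≤_) (sym (ℤ.*-identityʳ (+ (2 ℕ.* d ℕ.+ 3)))) (ℤ.+≤+ ℕ.z≤n))

-- `mkℚᵘ` stores the denominator minus one, so `exponent d` is (2d+3)/4, below the target by exactly
-- 1/4. Cross-multiplied, this is 4d + 6 < 4d + 8.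
exponent<d/2+1 : ∀ d → exponent d ℚ.< (+ d) / 2 + 1ℚᵘ
exponent<d/2+1 d = *<* (subst₂ ℤ._<_ (ℤ.pos-* (2 ℕ.* d ℕ.+ 3) 2) numerator (ℤ.+<+ bound))
  where
  open ℕ.≤-Reasoning
  numerator : + ((d ℕ.+ 2) ℕ.* 4) ≡ (+ d ℤ.* + 1 ℤ.+ + 2) ℤ.* + 4
  numerator = trans (ℤ.pos-* (d ℕ.+ 2) 4)
    (cong (λ i → (i ℤ.+ + 2) ℤ.* + 4) (sym (ℤ.*-identityʳ (+ d))))
  regroup : ∀ d → ℕ.suc ((2 ℕ.* d ℕ.+ 3) ℕ.* 2) ℕ.+ 1 ≡ (d ℕ.+ 2) ℕ.* 4
  regroup = solve-∀
  bound : (2 ℕ.* d ℕ.+ 3) ℕ.* 2 ℕ.< (d ℕ.+ 2) ℕ.* 4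
  bound = begin
    ℕ.suc ((2 ℕ.* d ℕ.+ 3) ℕ.* 2)          ≤⟨ ℕ.m≤m+n _ 1 ⟩
    ℕ.suc ((2 ℕ.* d ℕ.+ 3) ℕ.* 2) ℕ.+ 1    ≡⟨ regroup d ⟩
    (d ℕ.+ 2) ℕ.* 4                        ∎

-- The semiring of polynomials and its finite sums

module _ {c ℓ₁ ℓ₂} (F : HeytingField c ℓ₁ ℓ₂) where

  private module K = HeytingField F

  polySemiring : Set → CommutativeSemiring c (c ⊔ ℓ₁)
  polySemiring V = record
    { Carrier = Poly F V
    ; _≈_ = _≈ₚ_ F
    ; _+_ = _+ₚ_
    ; _*_ = _*ₚ_
    ; 0# = con K.0#
    ; 1# = con K.1#
    ; isCommutativeSemiring = isCommutativeSemiringˡ record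
      { +-isCommutativeMonoid = isCommutativeMonoidˡ record
        { isSemigroup = record
          { isMagma = record { isEquivalence = isEquivalence ; ∙-cong = +ₚ-cong }
          ; assoc = +ₚ-assoc }
        ; identityˡ = +ₚ-identity
        ; comm = +ₚ-comm }
      ; *-isCommutativeMonoid = isCommutativeMonoidˡ record
        { isSemigroup = record
          { isMagma = record { isEquivalence = isEquivalence ; ∙-cong = *ₚ-cong }
          ; assoc = *ₚ-assoc }
        ; identityˡ = *ₚ-identity
        ; comm = *ₚ-comm }
      ; distribʳ = λ p q r → ≈ₚ-trans (*ₚ-comm (q +ₚ r) p)
          (≈ₚ-trans (*ₚ-distrib p q r) (+ₚ-cong (*ₚ-comm p q) (*ₚ-comm p r)))
      ; zeroˡ = *ₚ-zero } }
    where
    isEquivalence : IsEquivalence (_≈ₚ_ F {V})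
    isEquivalence = record { refl = ≈ₚ-refl ; sym = ≈ₚ-sym ; trans = ≈ₚ-trans }

  module _ {V : Set} where

    open CommutativeSemiring (polySemiring V)
      using (_≈_; setoid; +-identityʳ; zeroʳ)
      renaming (reflexive to ≈-reflexive)
    open import Algebra.Properties.CommutativeSemigroup
      (CommutativeSemiring.+-commutativeSemigroup (polySemiring V))
      using () renaming (interchange to +-interchange)
    open import Relation.Binary.Reasoning.Setoid setoid

    sumOver : ∀ {a} {A : Set a} → List A → (A → Poly F V) → Poly F V
    sumOver xs f = sumₚ F (map f xs)

    sumOver-cong : {A : Set} (xs : List A) {f g : A → Poly F V} →
      (∀ x → f x ≈ g x) → sumOver xs f ≈ sumOver xs g
    sumOver-cong []       f≈g = ≈ₚ-refl
    sumOver-cong (x ∷ xs) f≈g = +ₚ-cong (f≈g x) (sumOver-cong xs f≈g)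

    sumOver-map : ∀ {b} {A : Set} {B : Set b} (h : A → B) (xs : List A) (f : B → Poly F V) →
      sumOver (map h xs) f ≡ sumOver xs (f ∘ h)
    sumOver-map h xs f = cong (sumₚ F) (sym (map-∘ xs))

    sumOver-++ : {A : Set} (xs ys : List A) (f : A → Poly F V) →
      sumOver (xs ++ ys) f ≈ sumOver xs f +ₚ sumOver ys f
    sumOver-++ []       ys f = ≈ₚ-sym (+ₚ-identity _)
    sumOver-++ (x ∷ xs) ys f =
      ≈ₚ-trans (+ₚ-cong ≈ₚ-refl (sumOver-++ xs ys f)) (≈ₚ-sym (+ₚ-assoc _ _ _))

    sumOver-product : {A B D : Set} (g : A → B → D) (xs : List A) (ys : List B)
      (f : D → Poly F V) → sumOver (cartesianProductWith g xs ys) f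
                         ≈ sumOver xs (λ x → sumOver ys (λ y → f (g x y)))
    sumOver-product g []       ys f = ≈ₚ-refl
    sumOver-product g (x ∷ xs) ys f =
      ≈ₚ-trans (sumOver-++ (map (g x) ys) _ f)
        (+ₚ-cong (≈-reflexive (sumOver-map (g x) ys f)) (sumOver-product g xs ys f))

    sumOver-0 : {A : Set} (xs : List A) → sumOver xs (λ _ → con K.0#) ≈ con K.0#
    sumOver-0 []       = ≈ₚ-refl
    sumOver-0 (x ∷ xs) = ≈ₚ-trans (+ₚ-identity _) (sumOver-0 xs)

    sumOver-+ : {A : Set} (xs : List A) (f g : A → Poly F V) →
      sumOver xs (λ x → f x +ₚ g x) ≈ sumOver xs f +ₚ sumOver xs g
    sumOver-+ []       f g = ≈ₚ-sym (+ₚ-identity _)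
    sumOver-+ (x ∷ xs) f g =
      ≈ₚ-trans (+ₚ-cong ≈ₚ-refl (sumOver-+ xs f g)) (+-interchange _ _ _ _)

    sumOver-swap : {A B : Set} (xs : List A) (ys : List B) (f : A → B → Poly F V) →
      sumOver xs (λ x → sumOver ys (f x)) ≈ sumOver ys (λ y → sumOver xs (λ x → f x y))
    sumOver-swap []       ys f = ≈ₚ-sym (sumOver-0 ys)
    sumOver-swap (x ∷ xs) ys f =
      ≈ₚ-trans (+ₚ-cong ≈ₚ-refl (sumOver-swap xs ys f)) (≈ₚ-sym (sumOver-+ ys _ _))

    *-sumOver : {A : Set} (p : Poly F V) (xs : List A) (f : A → Poly F V) →
      p *ₚ sumOver xs f ≈ sumOver xs (λ x → p *ₚ f x)
    *-sumOver p []       f = zeroʳ p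
    *-sumOver p (x ∷ xs) f =
      ≈ₚ-trans (*ₚ-distrib p _ _) (+ₚ-cong ≈ₚ-refl (*-sumOver p xs f))

    sumOver-tabulate : ∀ {A : Set} k (h : Fin k → A) (f : A → Poly F V) →
      sumOver (tabulate h) f ≡ sumOver (allFin k) (f ∘ h)
    sumOver-tabulate k h f =
      cong (sumₚ F) (trans (map-tabulate h f) (sym (map-tabulate (λ i → i) (f ∘ h))))

    sumOver-combine : ∀ m {n} (f : Fin (m ℕ.* n) → Poly F V) →
      sumOver (allFin (m ℕ.* n)) f
        ≈ sumOver (allFin m) (λ i → sumOver (allFin n) (λ j → f (combine i j)))
    sumOver-combine ℕ.zero        f = ≈ₚ-refl
    sumOver-combine (ℕ.suc m) {n} f = begin
      sumOver (allFin (n ℕ.+ m ℕ.* n)) f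
        ≡⟨ cong (λ is → sumOver is f) (tabulate-+ n (λ i → i)) ⟩
      sumOver (tabulate (_↑ˡ (m ℕ.* n)) ++ tabulate (n ↑ʳ_)) f
        ≈⟨ sumOver-++ (tabulate (_↑ˡ (m ℕ.* n))) _ f ⟩
      sumOver (tabulate (_↑ˡ (m ℕ.* n))) f +ₚ sumOver (tabulate (n ↑ʳ_)) f
        -- By definition `combine zero j` is `j ↑ˡ (m * n)` and `combine (suc i) j` is
        -- `n ↑ʳ combine i j`, so the two parts are the row of `zero` and the rows for the
        -- recursion.
        ≡⟨ cong₂ _+ₚ_ (sumOver-tabulate n (_↑ˡ (m ℕ.* n)) f)
                      (sumOver-tabulate (m ℕ.* n) (n ↑ʳ_) f) ⟩
      sumOver (allFin n) (f ∘ combine {ℕ.suc m} zero) +ₚ sumOver (allFin (m ℕ.* n)) (f ∘ (n ↑ʳ_))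
        ≈⟨ +ₚ-cong ≈ₚ-refl (sumOver-combine m (f ∘ (n ↑ʳ_))) ⟩
      sumOver (allFin n) (f ∘ combine {ℕ.suc m} zero)
        +ₚ sumOver (allFin m) (λ i → sumOver (allFin n) (λ j → f (combine (suc i) j)))
        ≡⟨ cong (sumOver (allFin n) (f ∘ combine {ℕ.suc m} zero) +ₚ_)
             (sumOver-tabulate m suc (λ i → sumOver (allFin n) (λ j → f (combine i j)))) ⟨
      sumOver (allFin (ℕ.suc m)) (λ i → sumOver (allFin n) (λ j → f (combine i j))) ∎

    sumOver-combineᵛ : ∀ e {m n} (f : Vec (Fin (m ℕ.* n)) e → Poly F V) →
      sumOver (allIndices e (m ℕ.* n)) f
        ≈ sumOver (allIndices e m) (λ v → sumOver (allIndices e n) (λ w → f (combineᵛ v w)))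
    sumOver-combineᵛ ℕ.zero            f = ≈ₚ-sym (+-identityʳ _)
    sumOver-combineᵛ (ℕ.suc e) {m} {n} f = begin
      sumOver (allIndices (ℕ.suc e) (m ℕ.* n)) f
        ≈⟨ sumOver-product Vec._∷_ (allFin (m ℕ.* n)) _ f ⟩
      sumOver (allFin (m ℕ.* n)) (λ l → sumOver (allIndices e (m ℕ.* n)) (λ x → f (l Vec.∷ x)))
        ≈⟨ sumOver-combine m _ ⟩
      sumOver (allFin m) (λ i → sumOver (allFin n) (λ j →
        sumOver (allIndices e (m ℕ.* n)) (λ x → f (combine i j Vec.∷ x))))
        ≈⟨ sumOver-cong (allFin m) (λ i → sumOver-cong (allFin n) (λ j → sumOver-combineᵛ e _)) ⟩
      sumOver (allFin m) (λ i → sumOver (allFin n) (λ j →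
        sumOver (allIndices e m) (λ v → sumOver (allIndices e n) (λ w → g (i Vec.∷ v) (j Vec.∷ w)))))
        -- The sums now run over i, j, v, w. Exchanging j with v puts i next to v and j next to w,
        -- which are then joined into longer vectors.
        ≈⟨ sumOver-cong (allFin m) (λ i → sumOver-swap (allFin n) (allIndices e m) _) ⟩
      sumOver (allFin m) (λ i → sumOver (allIndices e m) (λ v →
        sumOver (allFin n) (λ j → sumOver (allIndices e n) (λ w → g (i Vec.∷ v) (j Vec.∷ w)))))
        ≈⟨ sumOver-cong (allFin m) (λ i → sumOver-cong (allIndices e m) (λ v →
             sumOver-product Vec._∷_ (allFin n) _ _)) ⟨
      sumOver (allFin m) (λ i → sumOver (allIndices e m) (λ v →
        sumOver (allIndices (ℕ.suc e) n) (g (i Vec.∷ v))))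
        ≈⟨ sumOver-product Vec._∷_ (allFin m) _ _ ⟨
      sumOver (allIndices (ℕ.suc e) m) (λ v → sumOver (allIndices (ℕ.suc e) n) (g v)) ∎
      where
      g : Vec (Fin m) (ℕ.suc e) → Vec (Fin n) (ℕ.suc e) → Poly F V
      g v w = f (combineᵛ v w)

    sumOver-++ᵛ : ∀ d e {n} (f : Vec (Fin n) (d ℕ.+ e) → Poly F V) →
      sumOver (allIndices (d ℕ.+ e) n) f
        ≈ sumOver (allIndices d n) (λ u → sumOver (allIndices e n) (λ w → f (u Vec.++ w)))
    sumOver-++ᵛ ℕ.zero    e     f = ≈ₚ-sym (+-identityʳ _)
    sumOver-++ᵛ (ℕ.suc d) e {n} f = begin
      sumOver (allIndices (ℕ.suc d ℕ.+ e) n) f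
        ≈⟨ sumOver-product Vec._∷_ (allFin n) _ f ⟩
      sumOver (allFin n) (λ i → sumOver (allIndices (d ℕ.+ e) n) (λ v → f (i Vec.∷ v)))
        ≈⟨ sumOver-cong (allFin n) (λ i → sumOver-++ᵛ d e _) ⟩
      sumOver (allFin n) (λ i → sumOver (allIndices d n) (λ u →
        sumOver (allIndices e n) (λ w → f (i Vec.∷ u Vec.++ w))))
        ≈⟨ sumOver-product Vec._∷_ (allFin n) _ _ ⟨
      sumOver (allIndices (ℕ.suc d) n) (λ u → sumOver (allIndices e n) (λ w → f (u Vec.++ w))) ∎

    productₚ-++ : ∀ (ps qs : List (Poly F V)) →
      productₚ F (ps ++ qs) ≈ productₚ F ps *ₚ productₚ F qs
    productₚ-++ []       qs = ≈ₚ-sym (*ₚ-identity _)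
    productₚ-++ (p ∷ ps) qs =
      ≈ₚ-trans (*ₚ-cong ≈ₚ-refl (productₚ-++ ps qs)) (≈ₚ-sym (*ₚ-assoc _ _ _))

    -- Building circuits by extension

    -- Inclusion is up to the polynomials computed, because vertices are numbered from the last one
    -- and every index shifts when a vertex is added.
    record _⊑_ {m m′} (C : Circuit F V m) (C′ : Circuit F V m′) : Set (c ⊔ ℓ₁) where
      field keep : ∀ {p} → Computes F C p → Computes F C′ p

    open _⊑_

    ⊑-refl : ∀ {m} {C : Circuit F V m} → C ⊑ C
    ⊑-refl .keep x = x

    ⊑-trans : ∀ {m m′ m″} {C : Circuit F V m} {C′ : Circuit F V m′} {C″ : Circuit F V m″} →
      C ⊑ C′ → C′ ⊑ C″ → C ⊑ C″
    ⊑-trans e e′ .keep x = e′ .keep (e .keep x)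

    ⊑-▷ : ∀ {m} {C : Circuit F V m} {g} → C ⊑ (C ▷ g)
    ⊑-▷ .keep (i , v≈p) = suc i , v≈p

    record Extension {m} (C : Circuit F V m) (s : ℕ) {I : Set} (f : I → Poly F V) :
        Set (c ⊔ ℓ₁) where
      field
        {order}  : ℕ
        circuit  : Circuit F V order
        extends  : C ⊑ circuit
        computes : ∀ i → Computes F circuit (f i)
        bounded  : size F circuit ℕ.≤ size F C ℕ.+ s

    open Extension

    -- Every extension of C, not only C itself, can compute the family f with s
    -- further wires; the quantification lets builds be sequenced.
    Builds : ∀ {m} (C : Circuit F V m) (s : ℕ) {I : Set} (f : I → Poly F V) → Set (c ⊔ ℓ₁)
    Builds C s f = ∀ {m′} {C′ : Circuit F V m′} → C ⊑ C′ → Extension C′ s f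

    infixl 1 _>>=_

    -- Costs add because each `bounded` is relative to the circuit it starts from. The continuation
    -- works in the enlarged circuit, so it may use any value of `f` repeatedly without paying for
    -- it again.
    _>>=_ : ∀ {m} {C : Circuit F V m} {s t} {I J : Set} {f : I → Poly F V} {g : J → Poly F V} →
      Builds C s f →
      (∀ {m′} {C′ : Circuit F V m′} → C ⊑ C′ → (∀ i → Computes F C′ (f i)) → Builds C′ t g) →
      Builds C (s ℕ.+ t) g
    _>>=_ {s = s} {t} b next {C′ = C′} C⊑C′ = record
      { circuit  = E₂ .circuit
      ; extends  = ⊑-trans (E₁ .extends) (E₂ .extends)
      ; computes = E₂ .computes
      ; bounded  = bound }
      where
      E₁ = b C⊑C′
      E₂ = next (⊑-trans C⊑C′ (E₁ .extends)) (E₁ .computes) ⊑-refl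
      bound : size F (E₂ .circuit) ℕ.≤ size F C′ ℕ.+ (s ℕ.+ t)
      bound = ℕ.≤-trans (E₂ .bounded) (ℕ.≤-trans (ℕ.+-monoˡ-≤ t (E₁ .bounded))
                 (ℕ.≤-reflexive (ℕ.+-assoc (size F C′) s t)))

    later : ∀ {m m′} {C : Circuit F V m} {C′ : Circuit F V m′} {s} {I : Set} {f : I → Poly F V} →
      C ⊑ C′ → Builds C s f → Builds C′ s f
    later C⊑C′ b C′⊑C″ = b (⊑-trans C⊑C′ C′⊑C″)

    -- For steps that add no wires: reindexing a family, or replacing polynomials by equal ones.
    conclude : ∀ {m} {C : Circuit F V m} {s} {I J : Set} {f : I → Poly F V} {g : J → Poly F V} →
      Builds C s f →
      (∀ {m′} {C′ : Circuit F V m′} → C ⊑ C′ → (∀ i → Computes F C′ (f i)) → ∀ j → Computes F C′ (g j)) →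
      Builds C s g
    conclude b next C⊑C′ = record
      { circuit  = E .circuit
      ; extends  = E .extends
      ; computes = next (⊑-trans C⊑C′ (E .extends)) (E .computes)
      ; bounded  = E .bounded }
      where E = b C⊑C′

    computes-cong : ∀ {m} {C : Circuit F V m} {p q} → p ≈ q → Computes F C p → Computes F C q
    computes-cong p≈q (i , v≈p) = i , ≈ₚ-trans v≈p p≈q

    -- Each build starts from the circuit left by the preceding one; `later` moves it there, and
    -- `keep` carries the earlier families to the end.
    forFin : ∀ {m} {C : Circuit F V m} {s} n {J : Set} {f : Fin n → J → Poly F V} →
      (∀ i → Builds C s (f i)) → Builds C (n ℕ.* s) (uncurry f)
    forFin ℕ.zero b {C′ = C′} _ = record
      { circuit  = C′
      ; extends  = ⊑-refl
      ; computes = λ ()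
      ; bounded  = ℕ.m≤m+n _ _ }
    forFin (ℕ.suc n) b = b zero >>= λ C⊑C′ first →
      conclude (forFin n (λ i → later C⊑C′ (b (suc i)))) λ where
        C′⊑C″ rest (zero  , j) → C′⊑C″ .keep (first j)
        C′⊑C″ rest (suc i , j) → rest (i , j)

    forVec : ∀ {m} {C : Circuit F V m} {s} d n {J : Set} {f : Vec (Fin n) d → J → Poly F V} →
      (∀ v → Builds C s (f v)) → Builds C (n ℕ.^ d ℕ.* s) (uncurry f)
    forVec {C = C} {s} ℕ.zero n {f = f} b =
      subst (λ t → Builds C t (uncurry f)) (sym (ℕ.*-identityˡ s))
        (conclude (b Vec.[]) λ { _ h (Vec.[] , j) → h j })
    forVec {C = C} {s} (ℕ.suc d) n {f = f} b =
      subst (λ t → Builds C t (uncurry f)) (sym (ℕ.*-assoc n (n ℕ.^ d) s))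
        (conclude (forFin n λ i → forVec d n λ v → b (i Vec.∷ v))
          λ { _ h (i Vec.∷ v , j) → h (i , v , j) })

    buildVertex : ∀ {m} {C : Circuit F V m} {s p} →
      (∀ {m′} {C′ : Circuit F V m′} → C ⊑ C′ →
        ∃[ g ] fanIn F g ≡ s × vertexValue F (value F C′) g ≈ p) →
      Builds C s (λ (_ : ⊤) → p)
    buildVertex vertex {C′ = C′} C⊑C′ = let g , fan , v≈p = vertex C⊑C′ in record
      { circuit  = C′ ▷ g
      ; extends  = ⊑-▷
      ; computes = λ _ → zero , v≈p
      ; bounded  = ℕ.≤-reflexive (cong (size F C′ ℕ.+_) fan) }

    buildVar : ∀ {m} {C : Circuit F V m} x → Builds C 0 (λ (_ : ⊤) → var x)
    buildVar x = buildVertex λ _ → input x , refl , ≈ₚ-refl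

    -- The coefficients label the wires, so a linear combination costs one wire per term and no
    -- product gates.
    buildSum : ∀ {m} {C : Circuit F V m} {A : Set} (xs : List A) (a : A → K.Carrier)
      (f : A → Poly F V) → (∀ x → Computes F C (f x)) →
      Builds C (length xs) (λ (_ : ⊤) → sumOver xs (λ x → con (a x) *ₚ f x))
    -- A gate has at least one wire, so the empty sum is a constant vertex instead.
    buildSum []           a f h = buildVertex λ _ → constant K.0# , refl , ≈ₚ-refl
    buildSum xs@(x ∷ xs′) a f h = buildVertex λ {_} {C′} C⊑C′ →
      let
        wire = λ y → proj₁ (C⊑C′ .keep (h y)) , a y
        gate-value : ∀ ys → sumₚ F (map (transmitted F (value F C′)) (map wire ys))
                            ≈ sumOver ys (λ y → con (a y) *ₚ f y)
        gate-value ys = ≈ₚ-trans (≈-reflexive (sumOver-map wire ys _))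
          (sumOver-cong ys λ y → *ₚ-cong ≈ₚ-refl (proj₂ (C⊑C′ .keep (h y))))
      in sumGate (wire x ∷ map wire xs′) , cong ℕ.suc (length-map wire xs′) , gate-value xs

    buildProduct : ∀ {m} {C : Circuit F V m} {A : Set} (xs : List A)
      (f : A → Poly F V) → (∀ x → Computes F C (f x)) →
      Builds C (length xs) (λ (_ : ⊤) → productₚ F (map f xs))
    -- Arises when a half of the modes is empty, as the first half is for d ≤ 1.
    buildProduct []           f h = buildVertex λ _ → constant K.1# , refl , ≈ₚ-refl
    buildProduct {A = A} xs@(x ∷ xs′) f h = buildVertex λ {_} {C′} C⊑C′ →
      let wire = λ y → proj₁ (C⊑C′ .keep (h y)) , K.1#
      in prodGate (wire x ∷ map wire xs′) , cong ℕ.suc (length-map wire xs′)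
         , gate-value (value F C′) wire (λ y → proj₂ (C⊑C′ .keep (h y))) xs
      where
      gate-value : ∀ {m′} (ρ : Fin m′ → Poly F V) (wire : A → Fin m′ × K.Carrier) →
        (∀ y → ρ (proj₁ (wire y)) ≈ f y) → ∀ ys →
        productₚ F (map (transmitted F ρ) (map (λ y → proj₁ (wire y) , K.1#) ys))
          ≈ productₚ F (map f ys)
      gate-value ρ wire ρ≈f []       = ≈ₚ-refl
      gate-value ρ wire ρ≈f (y ∷ ys) =
        *ₚ-cong (≈ₚ-trans (*ₚ-identity _) (ρ≈f y)) (gate-value ρ wire ρ≈f ys)

    buildPair : ∀ {m} {C : Circuit F V m} {p q} →
      Computes F C p → Computes F C q → Builds C 2 (λ (_ : ⊤) → p *ₚ q)
    buildPair {p = p} {q} hp hq =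
      conclude (buildProduct (true ∷ false ∷ []) (λ b → if b then p else q)
                 λ { true → hp ; false → hq })
        -- The list product ends in a factor `con 1#`, removed here.
        λ {_} {C′} _ h _ → computes-cong {C = C′}
          (*ₚ-cong ≈ₚ-refl (≈ₚ-trans (*ₚ-comm q (con K.1#)) (*ₚ-identity q))) (h tt)

    buildVecSum : ∀ {m} {C : Circuit F V m} d n (a : Vec (Fin n) d → K.Carrier)
      (f : Vec (Fin n) d → Poly F V) → (∀ v → Computes F C (f v)) →
      Builds C (n ℕ.^ d) (λ (_ : ⊤) → sumOver (allIndices d n) (λ v → con (a v) *ₚ f v))
    buildVecSum {C = C} d n a f h =
      subst (λ s → Builds C s (λ (_ : ⊤) → sumOver (allIndices d n) (λ v → con (a v) *ₚ f v)))
        (length-allIndices d n) (buildSum (allIndices d n) a f h)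

    buildMonomials : ∀ {m} {C : Circuit F V m} d n (x : Fin d → Fin n → V) →
      Builds C (n ℕ.^ d ℕ.* d) (λ v → productₚ F (map (λ i → var (x i (lookup v i))) (allFin d)))
    buildMonomials {C = C} d n x =
      conclude (forVec d n λ v → monomialOf v) λ _ h v → h (v , tt)
      where
      MonomialCost : Vec (Fin n) d → ℕ → Set (c ⊔ ℓ₁)
      MonomialCost v s =
        Builds C s (λ (_ : ⊤) → productₚ F (map (λ i → var (x i (lookup v i))) (allFin d)))
      monomialOf : ∀ v → MonomialCost v d
      monomialOf v = subst (MonomialCost v)
        -- Input vertices have no wires, so recreating them for each monomial is free; the `d` wires
        -- all enter the product gate.
        (cong₂ ℕ._+_ (ℕ.*-zeroʳ d) (length-tabulate {n = d} (λ i → i)))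
        (forFin d (λ i → buildVar (x i (lookup v i))) >>= λ _ h →
          buildProduct (allFin d) _ (λ i → h (i , tt)))

    -- Yates' algorithm

    module _ {d e n : ℕ} (T : Tensor F (d ℕ.+ e) n) where

      -- T^⊗k, flattened to a matrix, times the vector y.
      apply : ∀ k → (Vec (Fin (n ℕ.^ k)) e → Poly F V) → Vec (Fin (n ℕ.^ k)) d → Poly F V
      apply k y u = sumOver (allIndices e (n ℕ.^ k)) λ w → con (_^⊗_ F T k (u Vec.++ w)) *ₚ y w

      -- Write the column index as `combineᵛ j w`. The entry of the power then factors into an entry
      -- of `T` that depends on j but not on w, and an entry of `T ^⊗ k`; pulling the first out of
      -- the sum over w leaves `apply k` on the j-th block of `y`.
      apply-suc : ∀ k (y : Vec (Fin (n ℕ.^ ℕ.suc k)) e → Poly F V) (u : Vec (Fin (n ℕ.^ ℕ.suc k)) d) →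
        sumOver (allIndices e n) (λ j →
          con (T (Vec.map (quotient {n} (n ℕ.^ k)) u Vec.++ j))
            *ₚ apply k (λ w → y (combineᵛ j w)) (Vec.map (remainder {n} (n ℕ.^ k)) u))
          ≈ apply (ℕ.suc k) y u
      apply-suc k y u = ≈ₚ-sym (begin
        apply (ℕ.suc k) y u
          ≈⟨ sumOver-combineᵛ e {n} {N} _ ⟩
        sumOver (allIndices e n) (λ j → sumOver (allIndices e N) (λ w →
          con (_^⊗_ F T (ℕ.suc k) (u Vec.++ combineᵛ j w)) *ₚ y (combineᵛ j w)))
          ≈⟨ sumOver-cong (allIndices e n) (λ j → sumOver-cong (allIndices e N) (λ w →
               ≈ₚ-trans (*ₚ-cong (≈ₚ-trans (≈-reflexive (cong con (entry j w))) (con-* _ _)) ≈ₚ-refl)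
                        (*ₚ-assoc _ _ _))) ⟩
        sumOver (allIndices e n) (λ j → sumOver (allIndices e N) (λ w →
          con (T (q u Vec.++ j)) *ₚ (con (_^⊗_ F T k (r u Vec.++ w)) *ₚ y (combineᵛ j w))))
          ≈⟨ sumOver-cong (allIndices e n) (λ j → *-sumOver _ (allIndices e N) _) ⟨
        sumOver (allIndices e n) (λ j →
          con (T (q u Vec.++ j)) *ₚ apply k (λ w → y (combineᵛ j w)) (r u)) ∎)
        where
        N = n ℕ.^ k
        q : ∀ {l} → Vec (Fin (n ℕ.* N)) l → Vec (Fin n) l
        q = Vec.map (quotient {n} N)
        r : ∀ {l} → Vec (Fin (n ℕ.* N)) l → Vec (Fin N) l
        r = Vec.map (remainder {n} N)
        entry : ∀ j w → _^⊗_ F T (ℕ.suc k) (u Vec.++ combineᵛ j w)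
                      ≡ T (q u Vec.++ j) K.* _^⊗_ F T k (r u Vec.++ w)
        entry j w = cong₂ (λ v v′ → T v K.* _^⊗_ F T k v′)
          (trans (Vec.map-++ (quotient N) u _) (cong (q u Vec.++_) (quotient-combineᵛ j w)))
          (trans (Vec.map-++ (remainder {n} N) u _) (cong (r u Vec.++_) (remainder-combineᵛ j w)))

      -- All n^e blocks of `y` are transformed first. Each transformed entry is then shared by all
      -- rows whose trailing digits agree, which is what saves over forming every row separately.
      yates : ∀ k {m} {C : Circuit F V m} (y : Vec (Fin (n ℕ.^ k)) e → Poly F V) →
        (∀ w → Computes F C (y w)) → Builds C (yatesCost d e n k) (apply k y)
      yates ℕ.zero y h =
        conclude (forVec d 1 λ u → buildVecSum e 1 _ y h) λ _ h′ u → h′ (u , tt)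
      yates (ℕ.suc k) y h =
        (forVec e n λ j → yates k (λ w → y (combineᵛ j w)) (λ w → h (combineᵛ j w)))
        >>= λ _ blocks →
        -- Row `u` takes from block j the entry at the trailing digits of `u`; unification with
        -- `apply-suc` finds it.
        conclude (forVec d (n ℕ.^ ℕ.suc k) λ u → buildVecSum e n _ _ λ j → blocks (j , _))
          λ {_} {C′} _ h′ u → computes-cong {C = C′} (apply-suc k y u) (h′ (u , tt))

  -- Circuits for Kronecker powers

  monomial-++ : ∀ {d e n} (u : Vec (Fin n) d) (w : Vec (Fin n) e) →
    _≈ₚ_ F (monomial F (u Vec.++ w))
      (productₚ F (map (λ i → var (i ↑ˡ e , lookup u i)) (allFin d))
        *ₚ productₚ F (map (λ i → var (d ↑ʳ i , lookup w i)) (allFin e)))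
  monomial-++ {d} {e} {n} u w = begin
    productₚ F (map x (allFin (d ℕ.+ e)))
      ≡⟨ cong (productₚ F) (trans (map-tabulate (λ i → i) x) (tabulate-+ d x)) ⟩
    productₚ F (tabulate (x ∘ (_↑ˡ e)) ++ tabulate (x ∘ (d ↑ʳ_)))
      ≈⟨ productₚ-++ (tabulate (x ∘ (_↑ˡ e))) (tabulate (x ∘ (d ↑ʳ_))) ⟩
    productₚ F (tabulate (x ∘ (_↑ˡ e))) *ₚ productₚ F (tabulate (x ∘ (d ↑ʳ_)))
      ≡⟨ cong₂ (λ ps qs → productₚ F ps *ₚ productₚ F qs)
           (trans (tabulate-cong (λ i → cong (λ a → var (i ↑ˡ e , a)) (Vec.lookup-++ˡ u w i)))
                  (sym (map-tabulate (λ i → i) _)))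
           (trans (tabulate-cong (λ i → cong (λ a → var (d ↑ʳ i , a)) (Vec.lookup-++ʳ u w i)))
                  (sym (map-tabulate (λ i → i) _))) ⟩
    productₚ F (map (λ i → var (i ↑ˡ e , lookup u i)) (allFin d))
      *ₚ productₚ F (map (λ i → var (d ↑ʳ i , lookup w i)) (allFin e)) ∎
    where
    open import Relation.Binary.Reasoning.Setoid
      (CommutativeSemiring.setoid (polySemiring (Fin (d ℕ.+ e) × Fin n)))
    x : Fin (d ℕ.+ e) → Poly F (Fin (d ℕ.+ e) × Fin n)
    x i = var (i , lookup (u Vec.++ w) i)

  -- Serves the case `n = 1`, where every power has a single monomial.
  buildNaive : ∀ {d n} (T : Tensor F d n) →
    Builds ∅ (n ℕ.^ d ℕ.* d ℕ.+ n ℕ.^ d) (λ (_ : ⊤) → toPoly F T)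
  buildNaive {d} {n} T = buildMonomials d n _,_ >>= λ _ → buildVecSum d n T (monomial F)

  buildPower : ∀ {d e n} (T : Tensor F (d ℕ.+ e) n) k →
    Builds ∅ (splitCost d e n k) (λ (_ : ⊤) → toPoly F (_^⊗_ F T k))
  buildPower {d} {e} {n} T k =
    buildMonomials e N (λ i a → d ↑ʳ i , a) >>= λ _ ys →
    yates T k y ys >>= λ _ zs →
    buildMonomials d N (λ i a → i ↑ˡ e , a) >>= λ C⊑C′ xs →
    -- The output of Yates precedes the monomials of the first half, so it is carried across their
    -- construction by `keep`.
    (forVec d N λ u → buildPair (xs u) (C⊑C′ ._⊑_.keep (zs u))) >>= λ _ products →
    -- All coefficients of the tensor already sit inside `apply`, so the final sum has weights 1.
    conclude (buildVecSum d N (λ _ → K.1#) _ (λ u → products (u , tt)))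
      λ {_} {C′} _ h _ → computes-cong {C = C′} (≈ₚ-sym toPoly-split) (h tt)
    where
    N = n ℕ.^ k
    V = Fin (d ℕ.+ e) × Fin N
    open import Relation.Binary.Reasoning.Setoid (CommutativeSemiring.setoid (polySemiring V))
    open import Algebra.Properties.CommutativeSemigroup
      (CommutativeSemiring.*-commutativeSemigroup (polySemiring V)) using (x∙yz≈y∙xz)
    x : Vec (Fin N) d → Poly F V
    x u = productₚ F (map (λ i → var (i ↑ˡ e , lookup u i)) (allFin d))
    y : Vec (Fin N) e → Poly F V
    y w = productₚ F (map (λ i → var (d ↑ʳ i , lookup w i)) (allFin e))
    toPoly-split : _≈ₚ_ F (toPoly F (_^⊗_ F T k))
      (sumOver (allIndices d N) (λ u → con K.1# *ₚ (x u *ₚ apply T k y u)))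
    toPoly-split = begin
      toPoly F (_^⊗_ F T k)
        ≈⟨ sumOver-++ᵛ d e _ ⟩
      sumOver (allIndices d N) (λ u → sumOver (allIndices e N) (λ w →
        con (_^⊗_ F T k (u Vec.++ w)) *ₚ monomial F (u Vec.++ w)))
        -- The first-half monomial moves in front of the coefficient, where it no longer depends on
        -- w and can leave the inner sum.
        ≈⟨ sumOver-cong (allIndices d N) (λ u → sumOver-cong (allIndices e N) (λ w →
             ≈ₚ-trans (*ₚ-cong ≈ₚ-refl (monomial-++ u w)) (x∙yz≈y∙xz _ _ _))) ⟩
      sumOver (allIndices d N) (λ u → sumOver (allIndices e N) (λ w →
        x u *ₚ (con (_^⊗_ F T k (u Vec.++ w)) *ₚ y w)))
        ≈⟨ sumOver-cong (allIndices d N) (λ u →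
             ≈ₚ-trans (*ₚ-identity _) (*-sumOver (x u) (allIndices e N) _)) ⟨
      sumOver (allIndices d N) (λ u → con K.1# *ₚ (x u *ₚ apply T k y u)) ∎

  build⇒C≤ : ∀ {d n s} {T : Tensor F d n} →
    Builds ∅ s (λ (_ : ⊤) → toPoly F T) → C[_]≤_ F T s
  build⇒C≤ b = let open Extension (b ⊑-refl) in order , circuit , computes tt , bounded

  -- Bounds for all powers

  -- The number of modes enters as a variable `D` with an equation, so that matching on `refl`
  -- splits the modes of `T` without transporting it.
  powerBound-≥2 : ∀ {D n} d e h → 2 ℕ.≤ n → d ℕ.≤ h → e ℕ.≤ h → h ℕ.+ h ℕ.≤ ℕ.suc (d ℕ.+ e) →
    d ℕ.+ e ≡ D → (T : Tensor F D n) → PowerBound F T (exponent D)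
  powerBound-≥2 {n = n} d e h 2≤n d≤h e≤h h+h≤ refl T =
    -- The 4 is the constant in k + 1 ≤ 4 · 2^⌊k/4⌋.
    4 ℕ.* splitFactor n h , 0 , λ k _ →
      splitCost d e n k , build⇒C≤ (buildPower {d} {e} T k) , splitCost^4-bound n 2≤n d≤h e≤h h+h≤ k

  -- Here n^(k/4) = 1 cannot absorb a factor k + 1, but the direct circuit has d + 1 wires for every
  -- k.
  powerBound-1 : ∀ {d} (T : Tensor F d 1) → PowerBound F T (exponent d)
  powerBound-1 {d} T = d ℕ.+ 1 , 0 , λ k _ →
    (1 ℕ.^ k) ℕ.^ d ℕ.* d ℕ.+ (1 ℕ.^ k) ℕ.^ d , build⇒C≤ (buildNaive (_^⊗_ F T k)) , bound k
    where
    open ℕ.≤-Reasoning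
    bound : ∀ k → ((1 ℕ.^ k) ℕ.^ d ℕ.* d ℕ.+ (1 ℕ.^ k) ℕ.^ d) ℕ.^ 4
                    ℕ.≤ (d ℕ.+ 1) ℕ.^ 4 ℕ.* 1 ℕ.^ ((2 ℕ.* d ℕ.+ 3) ℕ.* k)
    bound k = begin
      ((1 ℕ.^ k) ℕ.^ d ℕ.* d ℕ.+ (1 ℕ.^ k) ℕ.^ d) ℕ.^ 4
        ≡⟨ cong (λ x → (x ℕ.* d ℕ.+ x) ℕ.^ 4) (trans (cong (ℕ._^ d) (ℕ.^-zeroˡ k)) (ℕ.^-zeroˡ d)) ⟩
      (1 ℕ.* d ℕ.+ 1) ℕ.^ 4
        ≡⟨ cong (λ x → (x ℕ.+ 1) ℕ.^ 4) (ℕ.*-identityˡ d) ⟩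
      (d ℕ.+ 1) ℕ.^ 4
        ≡⟨ ℕ.*-identityʳ ((d ℕ.+ 1) ℕ.^ 4) ⟨
      (d ℕ.+ 1) ℕ.^ 4 ℕ.* 1
        ≡⟨ cong ((d ℕ.+ 1) ℕ.^ 4 ℕ.*_) (ℕ.^-zeroˡ ((2 ℕ.* d ℕ.+ 3) ℕ.* k)) ⟨
      (d ℕ.+ 1) ℕ.^ 4 ℕ.* 1 ℕ.^ ((2 ℕ.* d ℕ.+ 3) ℕ.* k) ∎

  powerBound : ∀ d n .{{_ : NonZero n}} (T : Tensor F d n) → PowerBound F T (exponent d)
  powerBound d ℕ.zero T = ⊥-elim (ℕ.≢-nonZero⁻¹ 0 refl)
  powerBound d 1 T = powerBound-1 T
  powerBound d n@(ℕ.suc (ℕ.suc _)) T =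
    powerBound-≥2 ℕ.⌊ d /2⌋ ℕ.⌈ d /2⌉ ℕ.⌈ d /2⌉ (ℕ.s≤s (ℕ.s≤s ℕ.z≤n))
      (ℕ.⌊n/2⌋≤⌈n/2⌉ d) ℕ.≤-refl twice-⌈d/2⌉ (ℕ.⌊n/2⌋+⌈n/2⌉≡n d) T
    where
    twice-⌈d/2⌉ : ℕ.⌈ d /2⌉ ℕ.+ ℕ.⌈ d /2⌉ ℕ.≤ ℕ.suc (ℕ.⌊ d /2⌋ ℕ.+ ℕ.⌈ d /2⌉)
    twice-⌈d/2⌉ = subst (λ δ → ℕ.⌈ d /2⌉ ℕ.+ ℕ.⌈ d /2⌉ ℕ.≤ ℕ.suc δ) (sym (ℕ.⌊n/2⌋+⌈n/2⌉≡n d))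
      -- `⌈ d /2⌉` is by definition `⌊ suc d /2⌋`, hence at most `⌈ suc d /2⌉`, and these two halves
      -- add up to d + 1.
      (ℕ.≤-trans (ℕ.+-monoʳ-≤ ℕ.⌈ d /2⌉ (ℕ.⌊n/2⌋≤⌈n/2⌉ (ℕ.suc d)))
        (ℕ.≤-reflexive (ℕ.⌊n/2⌋+⌈n/2⌉≡n (ℕ.suc d))))

theorem6 : ∀ {c ℓ₁ ℓ₂} (F : HeytingField c ℓ₁ ℓ₂) (d n : ℕ) .{{_ : NonZero n}} (T : Tensor F d n) → η F T <ᵘ (+ d) / 2 + 1ℚᵘ
theorem6 F d n T = exponent d , (exponent-nonNegative d , powerBound F d n T) , exponent<d/2+1 d
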